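{- Let $\mathbf u$ be an infinite word over a finite alphabet whose language is closed under reversal. Then $D(\mathbf u)<+\infty$ if and only if $\sum_{n=0}^{+\infty}T_{\mathbf u}(n)<+\infty$.
   Context: For a finite word $w=w_0\cdots w_{n-1}$ its reversal is $\overline{w}=w_{n-1}\cdots w_0$; $w$ is a palindrome if $w=\overline{w}$ (the empty word is a palindrome). The language $\mathcal L(\mathbf u)$ of an infinite word $\mathbf u$ is the set of its finite factors, $\mathcal L_n(\mathbf u)$ those of length $n$; the language is closed under reversal if $w\in\mathcal L(\mathbf u)$ implies $\overline{w}\in\mathcal L(\mathbf u)$. The defect of a finite word $w$ is $D(w)=|w|+1-(\text{number of distinct palindromic factors of } w, \text{ including the empty word})$. The defect of an infinite word is $D(\mathbf u)=\sup\{D(w): w \text{ a prefix of } \mathbf u\}$. The factor complexity is $\mathcal C_{\mathbf u}(n)=\#\mathcal L_n(\mathbf u)$, the palindromic complexity $\mathcal P_{\mathbf u}(n)$ is the number of palindromes in $\mathcal L_n(\mathbf u)$, and $T_{\mathbf u}(n)=\mathcal C_{\mathbf u}(n+1)-\mathcal C_{\mathbf u}(n)+2-\mathcal P_{\mathbf u}(n+1)-\mathcal P_{\mathbf u}(n)$ (it is known that $T_{\mathbf u}(n)\ge 0$ for such words). -}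

module Defs where

open import Data.Nat using (ℕ; zero; suc; _+_; _∸_; _≤_)
open import Data.Integer as ℤ using (ℤ; +_)
open import Data.Fin using (Fin)
import Data.Fin.Properties as FinP
open import Data.List using (List; []; _∷_; length; reverse; applyUpTo; take; filter; inits; tails; concatMap; deduplicate)
open import Data.List.Properties using (≡-dec)
open import Data.List.Membership.Propositional using (_∈_)
open import Data.List.Relation.Unary.Unique.Propositional using (Unique)
open import Data.Product using (Σ; ∃; _×_; _,_)
open import Function.Bundles using (_⇔_)
open import Relation.Binary.PropositionalEquality using (_≡_)
open import Relation.Nullary using (Dec)

Word : ℕ → Set
Word k = List (Fin k)

InfWord : ℕ → Set
InfWord k = ℕ → Fin k

_≟w_ : ∀ {k} (v w : Word k) → Dec (v ≡ w)
_≟w_ = ≡-dec FinP._≟_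

factorAt : ∀ {k} → InfWord k → ℕ → ℕ → Word k
factorAt u i n = applyUpTo (λ j → u (i + j)) n

prefix : ∀ {k} → InfWord k → ℕ → Word k
prefix u n = factorAt u 0 n

InLanguage : ∀ {k} → InfWord k → ℕ → Word k → Set
InLanguage u n w = ∃ λ i → w ≡ factorAt u i n

IsPalindrome : ∀ {k} → Word k → Set
IsPalindrome w = w ≡ reverse w

isPal? : ∀ {k} (w : Word k) → Dec (IsPalindrome w)
isPal? w = w ≟w reverse w

ClosedUnderReversal : ∀ {k} → InfWord k → Set
ClosedUnderReversal u = ∀ n w → InLanguage u n w → InLanguage u n (reverse w)

factorsOf : ∀ {k} → Word k → List (Word k)
factorsOf w = concatMap inits (tails w)

palFactors : ∀ {k} → Word k → List (Word k)
palFactors w = deduplicate _≟w_ (filter isPal? (factorsOf w))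

defect : ∀ {k} → Word k → ℕ
defect w = suc (length w) ∸ length (palFactors w)

FiniteDefect : ∀ {k} → InfWord k → Set
FiniteDefect u = Σ ℕ λ B → ∀ n → defect (prefix u n) ≤ B

IsFactorComplexity : ∀ {k} → InfWord k → (ℕ → ℕ) → Set
IsFactorComplexity {k} u c = ∀ n → Σ (List (Word k)) λ l →
  Unique l × length l ≡ c n × (∀ w → (w ∈ l) ⇔ InLanguage u n w)

IsPalindromicComplexity : ∀ {k} → InfWord k → (ℕ → ℕ) → Set
IsPalindromicComplexity {k} u p = ∀ n → Σ (List (Word k)) λ l →
  Unique l × length l ≡ p n × (∀ w → (w ∈ l) ⇔ (InLanguage u n w × IsPalindrome w))

T : (ℕ → ℕ) → (ℕ → ℕ) → ℕ → ℤ
T c p n = (((+ c (suc n) ℤ.- + c n) ℤ.+ + 2) ℤ.- + p (suc n)) ℤ.- + p n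

partialSum : (ℕ → ℤ) → ℕ → ℤ
partialSum f zero = + 0
partialSum f (suc N) = partialSum f N ℤ.+ f N

-- Σ_n f n < +∞ (for a series of nonnegative terms): bounded partial sums
FiniteSum : (ℕ → ℤ) → Set
FiniteSum f = Σ ℤ λ B → ∀ N → partialSum f N ℤ.≤ B

{-# OPTIONS --safe #-}
module Submission where

-- Telescoping gives Σ_{n<N} T(n) = C(N) + P(N) + 2N − 2 Σ_{n≤N} P(n), and closure under reversal makes
-- C(N) + P(N) twice the number of classes {f , reverse f} of factors of length N.  Now read u letter by
-- letter, starting from its prefix v of length N.  Each letter creates at most one new palindrome.  If that
-- palindrome has length ≤ N, the factor of length N ending there belongs to a new class; if it has
-- length > N, it begins with the reversal of that factor, whose class is therefore old.  Counting over a
-- prefix w that contains all factors of length ≤ N yields 2 D(v) ≤ Σ_{n<N} T(n) ≤ 2 D(w).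

open import Defs
open import Data.Nat using (ℕ; zero; suc; _+_; _∸_; _*_; _≤_; _<_; _⊔_; z≤n; s≤s; s≤s⁻¹; _≤?_)
open import Data.Nat.Properties
open import Data.Nat.Tactic.RingSolver using () renaming (solve-∀ to ℕ-solve-∀)
open import Data.Integer as ℤ using (ℤ; ∣_∣) renaming (+_ to pos)
import Data.Integer.Properties as ℤ
open import Data.Integer.Tactic.RingSolver using () renaming (solve-∀ to ℤ-solve-∀)
open import Data.List using (List; []; _∷_; [_]; _++_; length; reverse; map; filter; applyUpTo; inits; tails)
open import Data.List.Properties using (length-++; length-++-sucʳ; length-map; length-applyUpTo; length-reverse; reverse-++; reverse-involutive; reverse-injective; ∷-injective; ++-assoc)
open import Data.List.Membership.Propositional using (_∈_; _∉_; lose; find)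
open import Data.List.Membership.Propositional.Properties using (∈-∃++; ∈-++⁺ˡ; ∈-++⁺ʳ; ∈-++⁻; ∈-map⁺; ∈-map⁻; ∈-filter⁺; ∈-filter⁻; ∈-concatMap⁺; ∈-concatMap⁻; ∈-deduplicate⁺; ∈-deduplicate⁻)
open import Data.List.Relation.Binary.Subset.Propositional using (_⊆_)
open import Data.List.Relation.Unary.All as All using (All; []; _∷_)
open import Data.List.Relation.Unary.Any using (here; there)
open import Data.List.Relation.Unary.AllPairs as AllPairs using (AllPairs; []; _∷_)
open import Data.List.Relation.Unary.Unique.Propositional using (Unique)
open import Data.List.Relation.Unary.Unique.Propositional.Properties as Unique using (Unique[x∷xs]⇒x∉xs)
open import Data.Product using (∃; ∃₂; _×_; _,_; proj₁; proj₂)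
open import Data.Sum as Sum using (_⊎_; inj₁; inj₂)
open import Function using (_∘_; case_of_)
open import Function.Bundles using (_⇔_; mk⇔; Equivalence)
open Equivalence using (to; from)
open import Relation.Binary.PropositionalEquality using (_≡_; _≢_; refl; sym; trans; cong; cong₂; subst; subst₂; module ≡-Reasoning)
open import Relation.Nullary using (¬_; Dec; yes; no; contradiction)
open import Relation.Nullary.Decidable using (¬?; map′)
open import Relation.Binary.Definitions using (tri<; tri≈; tri>)
open import Relation.Unary using (Pred; Decidable)

import Data.List.Membership.DecPropositional as DecMembership
import Data.List.Relation.Unary.Unique.DecPropositional.Properties as DecUnique

-- Lists: counting by inclusion, splitting, initial and final segments.

module _ {A : Set} where

  ++-injective : ∀ (xs ys : List A) {xs′ ys′} → length xs ≡ length ys →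
                 xs ++ xs′ ≡ ys ++ ys′ → xs ≡ ys × xs′ ≡ ys′
  ++-injective []       []       _ eq = refl , eq
  ++-injective (x ∷ xs) (y ∷ ys) l eq with refl , eq′ ← ∷-injective eq
    with refl , eq″ ← ++-injective xs ys (suc-injective l) eq′ = refl , eq″

  -- One occurrence of the head is deleted from `ys`; uniqueness keeps the tail inside what remains.
  -- Cardinalities are later compared through such inclusions.
  Unique-⊆⇒length≤ : ∀ {xs ys : List A} → Unique xs → xs ⊆ ys → length xs ≤ length ys
  Unique-⊆⇒length≤ {[]}     _ _ = z≤n
  Unique-⊆⇒length≤ {x ∷ xs} u@(_ ∷ u′) sub with ∈-∃++ (sub (here refl))
  ... | as , bs , refl rewrite length-++-sucʳ as x bs = s≤s (Unique-⊆⇒length≤ u′ sub′)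
    where
    sub′ : xs ⊆ as ++ bs
    sub′ z∈xs with ∈-++⁻ as (sub (there z∈xs))
    ... | inj₁ z∈as         = ∈-++⁺ˡ z∈as
    ... | inj₂ (here refl)  = contradiction z∈xs (Unique[x∷xs]⇒x∉xs u)
    ... | inj₂ (there z∈bs) = ∈-++⁺ʳ as z∈bs

  ∉⇒All≢ : ∀ {x : A} {xs} → x ∉ xs → All (x ≢_) xs
  ∉⇒All≢ x∉xs = All.tabulate λ { y∈xs refl → x∉xs y∈xs }

  length-filter-¬ : ∀ {ℓ} {P : Pred A ℓ} (P? : Decidable P) xs →
                    length (filter P? xs) + length (filter (¬? ∘ P?) xs) ≡ length xs
  length-filter-¬ P? []       = refl
  length-filter-¬ P? (x ∷ xs) with P? x
  ... | yes _ = cong suc (length-filter-¬ P? xs)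
  ... | no  _ = trans (+-suc _ _) (cong suc (length-filter-¬ P? xs))

  applyUpTo-cong : ∀ {f g : ℕ → A} → (∀ j → f j ≡ g j) → ∀ n → applyUpTo f n ≡ applyUpTo g n
  applyUpTo-cong eq zero    = refl
  applyUpTo-cong eq (suc n) = cong₂ _∷_ (eq 0) (applyUpTo-cong (eq ∘ suc) n)

  applyUpTo-+ : ∀ (f : ℕ → A) a b →
                applyUpTo f (a + b) ≡ applyUpTo f a ++ applyUpTo (λ j → f (a + j)) b
  applyUpTo-+ f zero    b = refl
  applyUpTo-+ f (suc a) b = cong (f 0 ∷_) (applyUpTo-+ (f ∘ suc) a b)

  ∈-inits⁺ : ∀ (xs : List A) {ys} → xs ∈ inits (xs ++ ys)
  ∈-inits⁺ []       = here refl
  ∈-inits⁺ (x ∷ xs) = there (∈-map⁺ (x ∷_) (∈-inits⁺ xs))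

  ∈-inits⁻ : ∀ ys {xs : List A} → xs ∈ inits ys → ∃ λ zs → ys ≡ xs ++ zs
  ∈-inits⁻ ys       (here refl) = ys , refl
  ∈-inits⁻ (y ∷ ys) (there xs∈) with ∈-map⁻ (y ∷_) xs∈
  ... | _ , xs∈′ , refl with ∈-inits⁻ ys xs∈′
  ... | zs , refl = zs , refl

  ∈-tails⁺ : ∀ (xs : List A) {ys} → ys ∈ tails (xs ++ ys)
  ∈-tails⁺ []       = here refl
  ∈-tails⁺ (x ∷ xs) = there (∈-tails⁺ xs)

  ∈-tails⁻ : ∀ ys {xs : List A} → xs ∈ tails ys → ∃ λ zs → ys ≡ zs ++ xs
  ∈-tails⁻ ys       (here refl) = [] , refl
  ∈-tails⁻ (y ∷ ys) (there xs∈) with ∈-tails⁻ ys xs∈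
  ... | zs , refl = y ∷ zs , refl

-- The upper index is included, unlike in `partialSum`: the terms T(n) with n < N involve P(0), ...,
-- P(N).
sumTo : (ℕ → ℕ) → ℕ → ℕ
sumTo f zero    = f zero
sumTo f (suc n) = f (suc n) + sumTo f n

module _ {k : ℕ} where

  open DecMembership (_≟w_ {k}) using (_∈?_)

  -- Palindromic factors of a finite word.

  ∈-factorsOf⁺ : ∀ (as w bs : Word k) → w ∈ factorsOf (as ++ w ++ bs)
  ∈-factorsOf⁺ as w bs = ∈-concatMap⁺ inits (lose (∈-tails⁺ as) (∈-inits⁺ w))

  ∈-factorsOf⁻ : ∀ v {w : Word k} → w ∈ factorsOf v → ∃₂ λ as bs → v ≡ as ++ w ++ bs
  ∈-factorsOf⁻ v w∈ with find (∈-concatMap⁻ inits {tails v} w∈)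
  ... | t , t∈ , w∈t with ∈-tails⁻ v t∈ | ∈-inits⁻ t w∈t
  ... | as , refl | bs , refl = as , bs , refl

  ∈-palFactors⁺ : ∀ (as w bs : Word k) → IsPalindrome w → w ∈ palFactors (as ++ w ++ bs)
  ∈-palFactors⁺ as w bs pal = ∈-deduplicate⁺ _≟w_ (∈-filter⁺ isPal? (∈-factorsOf⁺ as w bs) pal)

  ∈-palFactors⁻ : ∀ v {w : Word k} → w ∈ palFactors v →
                  IsPalindrome w × ∃₂ λ as bs → v ≡ as ++ w ++ bs
  ∈-palFactors⁻ v w∈ with ∈-filter⁻ isPal? {xs = factorsOf v} (∈-deduplicate⁻ _≟w_ (filter isPal? (factorsOf v)) w∈)
  ... | w∈f , pal = pal , ∈-factorsOf⁻ v w∈f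

  palFactors-! : ∀ (v : Word k) → Unique (palFactors v)
  palFactors-! v = DecUnique.deduplicate-! _≟w_ (filter isPal? (factorsOf v))

  -- Words up to reversal.

  reverse-sym : ∀ {v w : Word k} → v ≡ reverse w → w ≡ reverse v
  reverse-sym {w = w} refl = sym (reverse-involutive w)

  -- Palindromes are left single, so that one representative per class {f, reverse f} expands to all
  -- members of the classes without repetition.
  mirror : List (Word k) → List (Word k)
  mirror R = R ++ map reverse (filter (¬? ∘ isPal?) R)

  -- A palindrome is one word and is counted once more among the palindromes; any other class has
  -- two words. Either way a class contributes two, which is the source of C(N) + P(N) being twice
  -- the number of classes.
  length-mirror : ∀ R → length (mirror R) + length (filter isPal? R) ≡ length R + length R
  length-mirror R = begin
    length (mirror R) + length pals               ≡⟨ cong (_+ length pals) (length-++ R) ⟩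
    length R + length (map reverse nonpals) + length pals
                                                  ≡⟨ cong (λ n → length R + n + length pals) (length-map reverse nonpals) ⟩
    length R + length nonpals + length pals       ≡⟨ +-assoc (length R) _ _ ⟩
    length R + (length nonpals + length pals)     ≡⟨ cong (length R +_) (+-comm (length nonpals) _) ⟩
    length R + (length pals + length nonpals)     ≡⟨ cong (length R +_) (length-filter-¬ isPal? R) ⟩
    length R + length R                           ∎
    where
    open ≡-Reasoning
    pals nonpals : List (Word k)
    pals    = filter isPal? R
    nonpals = filter (¬? ∘ isPal?) R

  DistinctUpToReversal : List (Word k) → Set
  DistinctUpToReversal = AllPairs (λ f g → f ≢ g × f ≢ reverse g)

  -- `AllPairs` compares entries in list order only; `reverse-sym` covers the other order. The case
  -- `f ≡ g` stands apart because a palindrome equals its own reversal.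
  distinct-∈-∈ : ∀ {R f g} → DistinctUpToReversal R → f ∈ R → g ∈ R → f ≡ g ⊎ f ≢ reverse g
  distinct-∈-∈ (_ ∷ _)  (here refl) (here refl) = inj₁ refl
  distinct-∈-∈ (fs ∷ _) (here refl) (there g∈)  = inj₂ (proj₂ (All.lookup fs g∈))
  distinct-∈-∈ (gs ∷ _) (there f∈)  (here refl) = inj₂ (proj₂ (All.lookup gs f∈) ∘ reverse-sym)
  distinct-∈-∈ (_ ∷ ps) (there f∈)  (there g∈)  = distinct-∈-∈ ps f∈ g∈

  -- A word common to both halves would lie in `R` and be the reversal of a non-palindrome `g` of
  -- `R`; distinctness makes it `g` itself, so `g` would be a palindrome.
  mirror-unique : ∀ {R} → DistinctUpToReversal R → Unique (mirror R)
  mirror-unique {R} dist = Unique.++⁺ R! (Unique.map⁺ reverse-injective (Unique.filter⁺ (¬? ∘ isPal?) R!)) disjoint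
    where
    R! : Unique R
    R! = AllPairs.map proj₁ dist
    disjoint : ∀ {f} → ¬ (f ∈ R × f ∈ map reverse (filter (¬? ∘ isPal?) R))
    disjoint (f∈ , f∈map) with ∈-map⁻ reverse f∈map
    ... | g , g∈ , refl with ∈-filter⁻ (¬? ∘ isPal?) {xs = R} g∈
    ... | g∈R , ¬pal with distinct-∈-∈ dist f∈ g∈R
    ... | inj₁ eq = ¬pal (sym eq)
    ... | inj₂ ≢  = ≢ refl

  ∈-mirror : ∀ {R f} → f ∈ R ⊎ reverse f ∈ R → f ∈ mirror R
  ∈-mirror (inj₁ f∈) = ∈-++⁺ˡ f∈
  ∈-mirror {R} {f} (inj₂ f̄∈) with isPal? (reverse f)
  ... | yes pal = ∈-++⁺ˡ (subst (_∈ R) (trans pal (reverse-involutive f)) f̄∈)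
  ... | no ¬pal = ∈-++⁺ʳ R (subst (_∈ map reverse (filter (¬? ∘ isPal?) R)) (reverse-involutive f)
    (∈-map⁺ reverse (∈-filter⁺ (¬? ∘ isPal?) f̄∈ ¬pal)))

  -- Positions of factors in the infinite word.

  module _ (u : InfWord k) where

    length-factorAt : ∀ i n → length (factorAt u i n) ≡ n
    length-factorAt i n = length-applyUpTo _ n

    length-reverse-factorAt : ∀ i n → length (reverse (factorAt u i n)) ≡ n
    length-reverse-factorAt i n = trans (length-reverse (factorAt u i n)) (length-factorAt i n)

    factorAt-+ : ∀ i a b → factorAt u i (a + b) ≡ factorAt u i a ++ factorAt u (i + a) b
    factorAt-+ i a b = trans (applyUpTo-+ _ a b)
      (cong (factorAt u i a ++_) (applyUpTo-cong (λ j → cong u (sym (+-assoc i a j))) b))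

    factorAt-split : ∀ i a b c → factorAt u i (a + (b + c)) ≡
                     factorAt u i a ++ factorAt u (i + a) b ++ factorAt u (i + a + b) c
    factorAt-split i a b c = trans (factorAt-+ i a (b + c))
      (cong (factorAt u i a ++_) (factorAt-+ (i + a) b c))

    factorAt-middle : ∀ i {a b c} (as w bs : Word k) → length as ≡ a → length w ≡ b →
                      factorAt u i (a + (b + c)) ≡ as ++ w ++ bs → factorAt u (i + a) b ≡ w
    factorAt-middle i {c = c} as w bs refl refl eq =
      proj₁ (++-injective (factorAt u (i + length as) (length w)) w (length-factorAt _ _)
        (proj₂ (++-injective (factorAt u i (length as)) as (length-factorAt i _)
          (trans (sym (factorAt-split i (length as) (length w) c)) eq))))

    factorAt-sub : ∀ {i i′} a b c → factorAt u i (a + (b + c)) ≡ factorAt u i′ (a + (b + c)) →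
                   factorAt u (i + a) b ≡ factorAt u (i′ + a) b
    factorAt-sub {i} {i′} a b c eq =
      factorAt-middle i (factorAt u i′ a) (factorAt u (i′ + a) b) (factorAt u (i′ + a + b) c)
        (length-factorAt i′ a) (length-factorAt _ b) (trans eq (factorAt-split i′ a b c))

    -- Reversal swaps what precedes and what follows the middle block, so offset `a` becomes offset
    -- `c`.
    factorAt-sub-reverse : ∀ {i i′} a b c →
                           factorAt u i (c + (b + a)) ≡ reverse (factorAt u i′ (a + (b + c))) →
                           factorAt u (i + c) b ≡ reverse (factorAt u (i′ + a) b)
    factorAt-sub-reverse {i} {i′} a b c eq =
      factorAt-middle i (reverse C) (reverse B) (reverse A)
        (length-reverse-factorAt _ c) (length-reverse-factorAt _ b) (begin
          factorAt u i (c + (b + a))             ≡⟨ eq ⟩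
          reverse (factorAt u i′ (a + (b + c)))  ≡⟨ cong reverse (factorAt-split i′ a b c) ⟩
          reverse (A ++ B ++ C)                  ≡⟨ reverse-++ A (B ++ C) ⟩
          reverse (B ++ C) ++ reverse A          ≡⟨ cong (_++ reverse A) (reverse-++ B C) ⟩
          (reverse C ++ reverse B) ++ reverse A  ≡⟨ ++-assoc (reverse C) (reverse B) (reverse A) ⟩
          reverse C ++ reverse B ++ reverse A    ∎)
      where
      A = factorAt u i′ a
      B = factorAt u (i′ + a) b
      C = factorAt u (i′ + a + b) c
      open ≡-Reasoning

    -- Occurrence in the prefix of length `m`, recorded by a position so that arguments about
    -- overlaps become arithmetic.
    OccursIn : ℕ → Word k → Set
    OccursIn m w = ∃₂ λ i n → i + n ≤ m × w ≡ factorAt u i n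

    palFactors-sound : ∀ m {w} → w ∈ palFactors (prefix u m) → IsPalindrome w × OccursIn m w
    palFactors-sound m {w} w∈ with ∈-palFactors⁻ (prefix u m) w∈
    ... | pal , as , bs , eq = pal , length as , length w , bound , sym w≡
      where
      m≡ : m ≡ length as + (length w + length bs)
      m≡ = begin
        m                                   ≡⟨ length-factorAt 0 m ⟨
        length (prefix u m)                 ≡⟨ cong length eq ⟩
        length (as ++ w ++ bs)              ≡⟨ length-++ as ⟩
        length as + length (w ++ bs)        ≡⟨ cong (length as +_) (length-++ w) ⟩
        length as + (length w + length bs)  ∎
        where open ≡-Reasoning
      bound : length as + length w ≤ m
      bound = subst (length as + length w ≤_) (sym m≡) (+-monoʳ-≤ (length as) (m≤m+n _ _))
      w≡ : factorAt u (length as) (length w) ≡ w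
      w≡ = factorAt-middle 0 as w bs refl refl (trans (cong (prefix u) (sym m≡)) eq)

    palFactors-complete : ∀ m {w} → IsPalindrome w → OccursIn m w → w ∈ palFactors (prefix u m)
    palFactors-complete m pal (i , n , i+n≤m , refl) with m≤n⇒∃[o]m+o≡n i+n≤m
    ... | o , refl = subst (λ v → factorAt u i n ∈ palFactors v)
      (trans (sym (factorAt-split 0 i n o)) (cong (prefix u) (sym (+-assoc i n o))))
      (∈-palFactors⁺ (factorAt u 0 i) (factorAt u i n) (factorAt u (i + n) o) pal)

    -- Palindromes created by one further letter.

    OccursIn-mono : ∀ {m m′ w} → m ≤ m′ → OccursIn m w → OccursIn m′ w
    OccursIn-mono m≤m′ (i , n , i+n≤m , eq) = i , n , ≤-trans i+n≤m m≤m′ , eq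

    -- For palindromes, occurrence amounts to membership in the finite list
    -- `palFactors (prefix u m)`, which is decidable.
    palOccursIn? : ∀ m {w} → IsPalindrome w → Dec (OccursIn m w)
    palOccursIn? m {w} pal = map′ (proj₂ ∘ palFactors-sound m) (palFactors-complete m pal)
      (w ∈? palFactors (prefix u m))

    -- Reversal exchanges prefixes and suffixes. The case `j = i` serves palindromes, the case of
    -- two positions an earlier occurrence of a reversed factor.
    prefix≡reverse-suffix : ∀ {i j} a b → factorAt u j (a + b) ≡ reverse (factorAt u i (a + b)) →
                            factorAt u j b ≡ reverse (factorAt u (i + a) b)
    prefix≡reverse-suffix {i} {j} a b eq =
      subst (λ j′ → factorAt u j′ b ≡ reverse (factorAt u (i + a) b)) (+-identityʳ j)
        (factorAt-sub-reverse a b 0 (begin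
          factorAt u j (b + a)                  ≡⟨ cong (factorAt u j) (+-comm b a) ⟩
          factorAt u j (a + b)                  ≡⟨ eq ⟩
          reverse (factorAt u i (a + b))        ≡⟨ cong (λ b′ → reverse (factorAt u i (a + b′))) (+-identityʳ b) ⟨
          reverse (factorAt u i (a + (b + 0)))  ∎))
      where open ≡-Reasoning

    -- The shorter palindrome is a suffix of the longer one, so its reversal, which is the same
    -- word, is a prefix of the longer one. This copy starts at `i` and ends before the last letter.
    shorter-palSuffix-occurs : ∀ {m i n i′ n′} → i + n ≡ suc m → i′ + n′ ≡ suc m → i < i′ →
      IsPalindrome (factorAt u i n) → IsPalindrome (factorAt u i′ n′) →
      OccursIn m (factorAt u i′ n′)
    shorter-palSuffix-occurs {m} {i} {n} {i′} {n′} eq eq′ i<i′ pal pal′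
      with a , refl ← m≤n⇒∃[o]m+o≡n (<⇒≤ i<i′)
      with refl ← +-cancelˡ-≡ i n (a + n′) (trans eq (trans (sym eq′) (+-assoc i a n′)))
      = i , n′ , s≤s⁻¹ (subst (i + n′ <_) eq′ (+-monoˡ-< n′ i<i′)) ,
        trans pal′ (sym (prefix≡reverse-suffix a n′ pal))

    -- Appending a letter creates at most one palindrome, because a shorter palindromic suffix
    -- is also a prefix of a longer one.
    newPalindrome : ∀ m →
      (∀ {q} → IsPalindrome q → OccursIn (suc m) q → OccursIn m q) ⊎
      ∃₂ λ i n → i + n ≡ suc m × IsPalindrome (factorAt u i n) × ¬ OccursIn m (factorAt u i n) ×
        (∀ {q} → IsPalindrome q → OccursIn (suc m) q → OccursIn m q ⊎ q ≡ factorAt u i n)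
    -- The search runs over starting positions of suffixes; the strict bound admits `suc m`, the
    -- empty suffix.
    newPalindrome m with anyUpTo? new? (suc (suc m))
      where
      New : ℕ → Set
      New i = ∃ λ (pal : IsPalindrome (factorAt u i (suc m ∸ i))) → ¬ OccursIn m (factorAt u i (suc m ∸ i))
      new? : Decidable New
      new? i with isPal? (factorAt u i (suc m ∸ i))
      ... | no ¬pal = no (¬pal ∘ proj₁)
      ... | yes pal = map′ (pal ,_) proj₂ (¬? (palOccursIn? m pal))
    ... | no none = inj₁ old
      where
      old : ∀ {q} → IsPalindrome q → OccursIn (suc m) q → OccursIn m q
      old pal (i , n , i+n≤ , refl) with m≤n⇒m<n∨m≡n i+n≤
      ... | inj₁ i+n< = i , n , s≤s⁻¹ i+n< , refl
      ... | inj₂ i+n≡ with palOccursIn? m pal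
      ... | yes occ = occ
      ... | no ¬occ with refl ← trans (sym (m+n∸m≡n i n)) (cong (_∸ i) i+n≡) =
        contradiction (i , s≤s (m+n≤o⇒m≤o i i+n≤) , pal , ¬occ) none
    ... | yes (i , s≤s i≤ , pal , ¬occ) = inj₂ (i , suc m ∸ i , m+[n∸m]≡n i≤ , pal , ¬occ , other)
      where
      other : ∀ {q} → IsPalindrome q → OccursIn (suc m) q →
              OccursIn m q ⊎ q ≡ factorAt u i (suc m ∸ i)
      other pal′ (i′ , n′ , i′+n′≤ , refl) with m≤n⇒m<n∨m≡n i′+n′≤
      ... | inj₁ i′+n′< = inj₁ (i′ , n′ , s≤s⁻¹ i′+n′< , refl)
      -- Of two palindromic suffixes the one starting later is old: this settles `q` in one case and
      -- contradicts the newness of the chosen palindrome in the other.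
      ... | inj₂ i′+n′≡ with <-cmp i i′
      ... | tri< i<i′ _ _ = inj₁ (shorter-palSuffix-occurs (m+[n∸m]≡n i≤) i′+n′≡ i<i′ pal pal′)
      ... | tri> _ _ i′<i = contradiction (shorter-palSuffix-occurs i′+n′≡ (m+[n∸m]≡n i≤) i′<i pal′ pal) ¬occ
      ... | tri≈ _ refl _ = inj₂ (cong (factorAt u i) (trans (sym (m+n∸m≡n i n′)) (cong (_∸ i) i′+n′≡)))

    OccursIn-length : ∀ {m w} → OccursIn m w → length w ≤ m
    OccursIn-length (i , n , i+n≤m , refl) =
      subst (_≤ _) (sym (length-factorAt i n)) (≤-trans (m≤n+m n i) i+n≤m)

    -- Scanning the word letter by letter from its prefix of length N.

    module _ (N : ℕ) where

      -- One representative of each class {f , reverse f} of length-N factors of the prefix of length d + N.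
      record Classes (d : ℕ) : Set where
        field
          reps     : List (Word k)
          sound    : ∀ {f} → f ∈ reps → ∃ λ i → i ≤ d × f ≡ factorAt u i N
          complete : ∀ {i} → i ≤ d → factorAt u i N ∈ reps ⊎ reverse (factorAt u i N) ∈ reps
          distinct : DistinctUpToReversal reps

      open Classes

      module _ {d : ℕ} (C : Classes d) where

        private
          f : Word k
          f = factorAt u (suc d) N

        keepClass : f ∈ reps C ⊎ reverse f ∈ reps C → Classes (suc d)
        keepClass f∈ = record
          { reps     = reps C
          ; sound    = λ g∈ → let i , i≤d , eq = sound C g∈ in i , m≤n⇒m≤1+n i≤d , eq
          ; complete = λ i≤ → complete′ (m≤n⇒m<n∨m≡n i≤)
          ; distinct = distinct C
          }
          where
          complete′ : ∀ {i} → i < suc d ⊎ i ≡ suc d →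
                      factorAt u i N ∈ reps C ⊎ reverse (factorAt u i N) ∈ reps C
          complete′ (inj₁ i<)   = complete C (s≤s⁻¹ i<)
          complete′ (inj₂ refl) = f∈

        addClass : f ∉ reps C → reverse f ∉ reps C → Classes (suc d)
        addClass f∉ f̄∉ = record
          { reps     = f ∷ reps C
          ; sound    = λ where
              (here refl) → suc d , ≤-refl , refl
              (there g∈)  → let i , i≤d , eq = sound C g∈ in i , m≤n⇒m≤1+n i≤d , eq
          ; complete = λ i≤ → complete′ (m≤n⇒m<n∨m≡n i≤)
          ; distinct = All.tabulate (λ g∈ → (λ { refl → f∉ g∈ }) ,
                         (λ eq → f̄∉ (subst (_∈ reps C) (reverse-sym eq) g∈))) ∷ distinct C
          }
          where
          complete′ : ∀ {i} → i < suc d ⊎ i ≡ suc d →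
                      factorAt u i N ∈ f ∷ reps C ⊎ reverse (factorAt u i N) ∈ f ∷ reps C
          complete′ (inj₁ i<)   = Sum.map there there (complete C (s≤s⁻¹ i<))
          complete′ (inj₂ refl) = inj₁ (here refl)

        -- For a letter that creates no palindrome, the class of `f` may be old or new. Growth by at
        -- least 0 preserves `short-bound`, growth by at most 1 preserves `long-bound`.
        nextClasses : ∃ λ (C′ : Classes (suc d)) →
                      length (reps C) ≤ length (reps C′) × length (reps C′) ≤ suc (length (reps C))
        nextClasses with f ∈? reps C | reverse f ∈? reps C
        ... | yes f∈ | _      = keepClass (inj₁ f∈) , ≤-refl , n≤1+n _
        ... | no _   | yes f̄∈ = keepClass (inj₂ f̄∈) , ≤-refl , n≤1+n _
        ... | no f∉  | no f̄∉  = addClass f∉ f̄∉ , n≤1+n _ , ≤-refl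

        -- f ends with the palindrome, so an earlier occurrence of f or reverse f would contain it.
        short⇒newClass : ∀ {i n} → i + n ≡ suc d + N → n ≤ N → IsPalindrome (factorAt u i n) →
                         ¬ OccursIn (d + N) (factorAt u i n) → f ∉ reps C × reverse f ∉ reps C
        short⇒newClass {i} {n} eq n≤N pal ¬occ with a , N≡ ← m≤n⇒∃[o]m+o≡n n≤N
          with refl ← trans (+-comm a n) N≡
          with refl ← +-cancelʳ-≡ n i (suc d + a) (trans eq (sym (+-assoc (suc d) a n))) = f∉ , f̄∉
          where
          f∉ : f ∉ reps C
          -- Here `a` letters of `f` precede the palindrome, so an occurrence of `f` at `j` puts it
          -- at `j + a`.
          f∉ f∈ with j , j≤d , f≡ ← sound C f∈ = ¬occ (j + a , n ,
            subst (_≤ d + (a + n)) (sym (+-assoc j a n)) (+-monoˡ-≤ (a + n) j≤d) ,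
            factorAt-sub a n 0 (subst (λ n′ → factorAt u (suc d) (a + n′) ≡ factorAt u j (a + n′))
              (sym (+-identityʳ n)) f≡))
          f̄∉ : reverse f ∉ reps C
          -- An occurrence of `reverse f` at `j` begins with the reversed palindrome, that is, with
          -- the palindrome.
          f̄∉ f̄∈ with j , j≤d , f̄≡ ← sound C f̄∈ = ¬occ (j , n , +-mono-≤ j≤d (m≤n+m n a) ,
            trans pal (sym (prefix≡reverse-suffix a n (sym f̄≡))))

        -- A palindrome longer than N that ends with f starts with the reversal of f.
        long⇒oldClass : ∀ {i n} → i + n ≡ suc d + N → N < n → IsPalindrome (factorAt u i n) →
                        f ∈ reps C ⊎ reverse f ∈ reps C
        long⇒oldClass {i} {n} eq N<n pal with a , n≡ ← m≤n⇒∃[o]m+o≡n (<⇒≤ N<n)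
          with refl ← trans (+-comm a N) n≡
          with i+a≡ ← +-cancelʳ-≡ N (i + a) (suc d) (trans (+-assoc i a N) eq)
          -- From N < n follows 0 < a, hence i < i + a = suc d: the copy of `reverse f` at `i`
          -- starts at most at `d`.
          with complete C (s≤s⁻¹ (≤-trans (m<m+n i (+-cancelʳ-< N 0 a N<n)) (≤-reflexive i+a≡)))
             | subst (λ j → factorAt u i N ≡ reverse (factorAt u j N)) i+a≡ (prefix≡reverse-suffix a N pal)
        ... | inj₁ g∈ | g≡ = inj₂ (subst (_∈ reps C) g≡ g∈)
        ... | inj₂ ḡ∈ | g≡ = inj₁ (subst (_∈ reps C) (sym (reverse-sym g≡)) ḡ∈)

      -- A new short palindrome comes with a new class, a new long one does not; hence the two bounds.
      record Scan (d : ℕ) : Set where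
        field
          classes        : Classes d
          short long     : List (Word k)
          short-sound    : ∀ {q} → q ∈ short → IsPalindrome q × OccursIn (d + N) q × length q ≤ N
          short-complete : ∀ {q} → IsPalindrome q → OccursIn (d + N) q → length q ≤ N → q ∈ short
          short-unique   : Unique short
          long-complete  : ∀ {q} → IsPalindrome q → OccursIn (d + N) q → N < length q → q ∈ long
          -- The `suc` is the class of the starting prefix, whose own palindromes are the last
          -- summand. In `long-bound` each of the d steps adds at most 1 to the initial value 1.
          short-bound    : suc (length short) ≤ length (reps classes) + length (palFactors (prefix u N))
          long-bound     : length (reps classes) + length long ≤ suc d

      open Scan

      scan₀ : Scan 0
      scan₀ = record
        { classes        = record
            { reps     = [ prefix u N ]
            ; sound    = λ { (here refl) → 0 , z≤n , refl }
            ; complete = λ { z≤n → inj₁ (here refl) }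
            ; distinct = [] ∷ []
            }
        ; short          = palFactors (prefix u N)
        ; long           = []
        ; short-sound    = λ q∈ → let pal , occ = palFactors-sound N q∈ in pal , occ , OccursIn-length occ
        ; short-complete = λ pal occ _ → palFactors-complete N pal occ
        ; short-unique   = palFactors-! (prefix u N)
        ; long-complete  = λ _ occ N< → contradiction (OccursIn-length occ) (<⇒≱ N<)
        ; short-bound    = ≤-refl
        ; long-bound     = ≤-refl
        }

      scan₊ : ∀ {d} → Scan d → Scan (suc d)
      scan₊ {d} s with newPalindrome (d + N)
      ... | inj₁ old with C′ , lower , upper ← nextClasses (classes s) = record
        { classes        = C′
        ; short          = short s
        ; long           = long s
        ; short-sound    = λ q∈ → let pal , occ , l = short-sound s q∈ in pal , OccursIn-mono (n≤1+n _) occ , l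
        ; short-complete = λ pal occ → short-complete s pal (old pal occ)
        ; short-unique   = short-unique s
        ; long-complete  = λ pal occ → long-complete s pal (old pal occ)
        ; short-bound    = ≤-trans (short-bound s) (+-monoˡ-≤ _ lower)
        ; long-bound     = ≤-trans (+-monoˡ-≤ _ upper) (s≤s (long-bound s))
        }
      ... | inj₂ (i , n , eq , pal , ¬occ , other) with n ≤? N
      ...   | yes n≤N with f∉ , f̄∉ ← short⇒newClass (classes s) eq n≤N pal ¬occ = record
        { classes        = addClass (classes s) f∉ f̄∉
        ; short          = factorAt u i n ∷ short s
        ; long           = long s
        ; short-sound    = λ where
            (here refl) → pal , (i , n , ≤-reflexive eq , refl) , subst (_≤ N) (sym (length-factorAt i n)) n≤N
            (there q∈)  → let pal , occ , l = short-sound s q∈ in pal , OccursIn-mono (n≤1+n _) occ , l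
        ; short-complete = λ pal′ occ l → case other pal′ occ of λ where
            (inj₁ occ′) → there (short-complete s pal′ occ′ l)
            (inj₂ q≡)   → here q≡
        ; short-unique   = ∉⇒All≢ (λ q∈ → ¬occ (proj₁ (proj₂ (short-sound s q∈)))) ∷ short-unique s
        ; long-complete  = λ pal′ occ l → case other pal′ occ of λ where
            (inj₁ occ′) → long-complete s pal′ occ′ l
            (inj₂ refl) → contradiction n≤N (<⇒≱ (subst (N <_) (length-factorAt i n) l))
        ; short-bound    = s≤s (short-bound s)
        ; long-bound     = s≤s (long-bound s)
        }
      ...   | no n≰N = record
        { classes        = keepClass (classes s) (long⇒oldClass (classes s) eq (≰⇒> n≰N) pal)
        ; short          = short s
        ; long           = factorAt u i n ∷ long s
        ; short-sound    = λ q∈ → let pal , occ , l = short-sound s q∈ in pal , OccursIn-mono (n≤1+n _) occ , l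
        ; short-complete = λ pal′ occ l → case other pal′ occ of λ where
            (inj₁ occ′) → short-complete s pal′ occ′ l
            (inj₂ refl) → contradiction (subst (_≤ N) (length-factorAt i n) l) n≰N
        ; short-unique   = short-unique s
        ; long-complete  = λ pal′ occ l → case other pal′ occ of λ where
            (inj₁ occ′) → there (long-complete s pal′ occ′ l)
            (inj₂ q≡)   → here q≡
        ; short-bound    = short-bound s
        ; long-bound     = subst (_≤ suc (suc d)) (sym (+-suc _ _)) (s≤s (long-bound s))
        }

      scan : ∀ d → Scan d
      scan zero    = scan₀
      scan (suc d) = scan₊ (scan d)

    -- From the language to finite prefixes, and lists counted by the complexities.

    InLanguage-length : ∀ {n w} → InLanguage u n w → length w ≡ n
    InLanguage-length {n} (i , refl) = length-factorAt i n

    -- The maximum of the end points of one chosen occurrence of each word.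
    commonPrefix : ∀ n (ws : List (Word k)) → (∀ {w} → w ∈ ws → InLanguage u n w) →
                   ∃ λ M → ∀ {w} → w ∈ ws → OccursIn M w
    commonPrefix n []       lang = 0 , λ ()
    commonPrefix n (w ∷ ws) lang with i , w≡ ← lang (here refl) | M , occ ← commonPrefix n ws (lang ∘ there) =
      (i + n) ⊔ M , λ where
        (here refl) → i , n , m≤m⊔n _ _ , w≡
        (there w∈)  → OccursIn-mono (m≤n⊔m (i + n) M) (occ w∈)

    module _ {c p : ℕ → ℕ} (hc : IsFactorComplexity u c) (hp : IsPalindromicComplexity u p) where

      open Scan
      open Classes

      factors : ℕ → List (Word k)
      factors n = proj₁ (hc n)

      factors-! : ∀ n → Unique (factors n)
      factors-! n = proj₁ (proj₂ (hc n))

      length-factors : ∀ n → length (factors n) ≡ c n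
      length-factors n = proj₁ (proj₂ (proj₂ (hc n)))

      ∈-factors : ∀ {n w} → (w ∈ factors n) ⇔ InLanguage u n w
      ∈-factors {n} {w} = proj₂ (proj₂ (proj₂ (hc n))) w

      palindromes : ℕ → List (Word k)
      palindromes n = proj₁ (hp n)

      palindromes-! : ∀ n → Unique (palindromes n)
      palindromes-! n = proj₁ (proj₂ (hp n))

      length-palindromes : ∀ n → length (palindromes n) ≡ p n
      length-palindromes n = proj₁ (proj₂ (proj₂ (hp n)))

      ∈-palindromes : ∀ {n w} → (w ∈ palindromes n) ⇔ (InLanguage u n w × IsPalindrome w)
      ∈-palindromes {n} {w} = proj₂ (proj₂ (proj₂ (hp n))) w

      palindromesUpTo : ℕ → List (Word k)
      palindromesUpTo zero    = palindromes zero
      palindromesUpTo (suc N) = palindromes (suc N) ++ palindromesUpTo N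

      length-palindromesUpTo : ∀ N → length (palindromesUpTo N) ≡ sumTo p N
      length-palindromesUpTo zero    = length-palindromes zero
      length-palindromesUpTo (suc N) = trans (length-++ (palindromes (suc N)))
        (cong₂ _+_ (length-palindromes (suc N)) (length-palindromesUpTo N))

      ∈-palindromesUpTo⁺ : ∀ N {n w} → n ≤ N → InLanguage u n w → IsPalindrome w → w ∈ palindromesUpTo N
      ∈-palindromesUpTo⁺ zero    z≤n lang pal = from ∈-palindromes (lang , pal)
      ∈-palindromesUpTo⁺ (suc N) n≤ lang pal with m≤n⇒m<n∨m≡n n≤
      ... | inj₁ n<   = ∈-++⁺ʳ (palindromes (suc N)) (∈-palindromesUpTo⁺ N (s≤s⁻¹ n<) lang pal)
      ... | inj₂ refl = ∈-++⁺ˡ (from ∈-palindromes (lang , pal))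

      ∈-palindromesUpTo⁻ : ∀ N {w} → w ∈ palindromesUpTo N →
                           ∃ λ n → n ≤ N × InLanguage u n w × IsPalindrome w
      ∈-palindromesUpTo⁻ zero    w∈ = zero , z≤n , to ∈-palindromes w∈
      ∈-palindromesUpTo⁻ (suc N) w∈ with ∈-++⁻ (palindromes (suc N)) w∈
      ... | inj₁ w∈ₙ = suc N , ≤-refl , to ∈-palindromes w∈ₙ
      ... | inj₂ w∈′ with n , n≤N , lp ← ∈-palindromesUpTo⁻ N w∈′ = n , m≤n⇒m≤1+n n≤N , lp

      palindromesUpTo-! : ∀ N → Unique (palindromesUpTo N)
      palindromesUpTo-! zero    = palindromes-! zero
      palindromesUpTo-! (suc N) = Unique.++⁺ (palindromes-! (suc N)) (palindromesUpTo-! N) disjoint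
        where
        disjoint : ∀ {w} → ¬ (w ∈ palindromes (suc N) × w ∈ palindromesUpTo N)
        disjoint (w∈ , w∈′) with n , n≤N , lang , _ ← ∈-palindromesUpTo⁻ N w∈′ =
          <⇒≢ (s≤s n≤N) (trans (sym (InLanguage-length lang)) (InLanguage-length (proj₁ (to ∈-palindromes w∈))))

      -- The empty word is a palindrome. This is the initial value for the telescoping sum.
      c0≡p0 : c 0 ≡ p 0
      c0≡p0 = ≤-antisym
        (subst₂ _≤_ (length-factors 0) (length-palindromes 0) (Unique-⊆⇒length≤ (factors-! 0)
          λ w∈ → from ∈-palindromes (to ∈-factors w∈ , palindrome (to ∈-factors w∈))))
        (subst₂ _≤_ (length-palindromes 0) (length-factors 0) (Unique-⊆⇒length≤ (palindromes-! 0)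
          λ w∈ → from ∈-factors (proj₁ (to ∈-palindromes w∈))))
        where
        palindrome : ∀ {w} → InLanguage u 0 w → IsPalindrome w
        palindrome (_ , refl) = refl

      fullPrefix : ∀ N → ∃ λ M → ∀ {n w} → n ≤ N → InLanguage u n w → OccursIn M w
      fullPrefix zero with M , occ ← commonPrefix 0 (factors 0) (to ∈-factors) =
        M , λ { z≤n lang → occ (from ∈-factors lang) }
      fullPrefix (suc N) with M , occ ← commonPrefix (suc N) (factors (suc N)) (to ∈-factors)
                            | M′ , occ′ ← fullPrefix N =
        M ⊔ M′ , λ n≤ lang → case m≤n⇒m<n∨m≡n n≤ of λ where
          (inj₁ n<)   → OccursIn-mono (m≤n⊔m M M′) (occ′ (s≤s⁻¹ n<) lang)
          (inj₂ refl) → OccursIn-mono (m≤m⊔n M M′) (occ (from ∈-factors lang))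

      -- The two inequalities for a fixed length N.

      module _ (N : ℕ) where

        private
          M : ℕ
          M = proj₁ (fullPrefix N)

          s : Scan N M
          -- After `M` steps the scan has covered the prefix of length M + N, hence all factors of
          -- length at most N.
          s = scan N M

          R : List (Word k)
          R = reps (classes s)

          π : ℕ
          π = length (palFactors (prefix u N))

        reps-language : ∀ {f} → f ∈ R → InLanguage u N f
        reps-language f∈ with i , _ , eq ← sound (classes s) f∈ = i , eq

        reps-cover : ∀ {f} → InLanguage u N f → f ∈ R ⊎ reverse f ∈ R
        reps-cover lang with proj₂ (fullPrefix N) ≤-refl lang
        ... | i , n , i+n≤M , refl with refl ← trans (sym (InLanguage-length lang)) (length-factorAt i n) =
          complete (classes s) (m+n≤o⇒m≤o i i+n≤M)

        -- Closure under reversal places all of `mirror R` in the language, so `mirror R` is bounded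
        -- by C(N) and the palindromes of `R` by P(N).
        reps-upper : ClosedUnderReversal u → length R + length R ≤ c N + p N
        reps-upper closed = subst (_≤ c N + p N) (length-mirror R) (+-mono-≤
          (≤-trans (Unique-⊆⇒length≤ (mirror-unique (distinct (classes s))) (from ∈-factors ∘ lang))
            (≤-reflexive (length-factors N)))
          (≤-trans (Unique-⊆⇒length≤ (Unique.filter⁺ isPal? (AllPairs.map proj₁ (distinct (classes s))))
              (from ∈-palindromes ∘ langPal))
            (≤-reflexive (length-palindromes N))))
          where
          lang : ∀ {f} → f ∈ mirror R → InLanguage u N f
          lang f∈ with ∈-++⁻ R f∈
          ... | inj₁ f∈R = reps-language f∈R
          ... | inj₂ f∈map with g , g∈ , refl ← ∈-map⁻ reverse f∈map =
            closed N g (reps-language (proj₁ (∈-filter⁻ (¬? ∘ isPal?) {xs = R} g∈)))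
          langPal : ∀ {f} → f ∈ filter isPal? R → InLanguage u N f × IsPalindrome f
          langPal f∈ with f∈R , pal ← ∈-filter⁻ isPal? {xs = R} f∈ = reps-language f∈R , pal

        -- Every factor of length N lies in `mirror R`, and a palindrome, being its own reversal,
        -- lies in `R` itself.
        reps-lower : c N + p N ≤ length R + length R
        reps-lower = subst (c N + p N ≤_) (length-mirror R) (+-mono-≤
          (≤-trans (≤-reflexive (sym (length-factors N)))
            (Unique-⊆⇒length≤ (factors-! N) (∈-mirror ∘ reps-cover ∘ to ∈-factors)))
          (≤-trans (≤-reflexive (sym (length-palindromes N)))
            (Unique-⊆⇒length≤ (palindromes-! N) (λ f∈ → let lang , pal = to ∈-palindromes f∈ in
              ∈-filter⁺ isPal? (palCover pal (reps-cover lang)) pal))))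
          where
          palCover : ∀ {f} → IsPalindrome f → f ∈ R ⊎ reverse f ∈ R → f ∈ R
          palCover pal (inj₁ f∈) = f∈
          palCover pal (inj₂ f̄∈) = subst (_∈ R) (sym pal) f̄∈

        short≤sumTo : length (short s) ≤ sumTo p N
        short≤sumTo = ≤-trans
          (Unique-⊆⇒length≤ (short-unique s) λ q∈ → let pal , occ , l = short-sound s q∈ in language pal occ l)
          (≤-reflexive (length-palindromesUpTo N))
          where
          language : ∀ {q m} → IsPalindrome q → OccursIn m q → length q ≤ N → q ∈ palindromesUpTo N
          language pal (i , n , _ , refl) l =
            ∈-palindromesUpTo⁺ N (subst (_≤ N) (length-factorAt i n) l) (i , refl) pal

        -- By the choice of `M`, every palindrome of length at most N has occurred by the end of the
        -- scan.
        sumTo≤short : sumTo p N ≤ length (short s)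
        sumTo≤short = ≤-trans (≤-reflexive (sym (length-palindromesUpTo N))) (Unique-⊆⇒length≤ (palindromesUpTo-! N) λ q∈ →
          let n , n≤N , lang , pal = ∈-palindromesUpTo⁻ N q∈ in
          short-complete s pal (OccursIn-mono (m≤m+n M N) (proj₂ (fullPrefix N) n≤N lang))
            (subst (_≤ N) (sym (InLanguage-length lang)) n≤N))

        palFactors≤short+long : length (palFactors (prefix u (M + N))) ≤ length (short s) + length (long s)
        palFactors≤short+long = ≤-trans
          (Unique-⊆⇒length≤ (palFactors-! (prefix u (M + N))) split) (≤-reflexive (length-++ (short s)))
          where
          split : palFactors (prefix u (M + N)) ⊆ short s ++ long s
          split {q} q∈ with pal , occ ← palFactors-sound (M + N) q∈ with length q ≤? N
          ... | yes l = ∈-++⁺ˡ (short-complete s pal occ l)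
          ... | no ¬l = ∈-++⁺ʳ (short s) (long-complete s pal occ (≰⇒> ¬l))

        -- After telescoping, this is 2 D(v) ≤ T(0) + ... + T(N - 1) for the prefix v of length N,
        -- where D(v) = N + 1 - `π`, with all subtractions moved across.
        complexity-lower : ClosedUnderReversal u → 2 * suc (sumTo p N) ≤ (c N + p N) + 2 * π
        complexity-lower closed = begin
          2 * suc (sumTo p N)            ≤⟨ *-monoʳ-≤ 2 (s≤s sumTo≤short) ⟩
          2 * suc (length (short s))     ≤⟨ *-monoʳ-≤ 2 (short-bound s) ⟩
          2 * (length R + π)             ≡⟨ double (length R) π ⟩
          (length R + length R) + 2 * π  ≤⟨ +-monoˡ-≤ (2 * π) (reps-upper closed) ⟩
          (c N + p N) + 2 * π            ∎
          where
          open ≤-Reasoning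
          double : ∀ r x → 2 * (r + x) ≡ (r + r) + 2 * x
          double = ℕ-solve-∀

        -- The defect bound is applied to the scanned prefix of length M + N; `long-bound` then
        -- trades its long palindromes for classes.
        complexity-upper : ∀ {B} → (∀ n → defect (prefix u n) ≤ B) → (c N + p N) + 2 * N ≤ 2 * B + 2 * sumTo p N
        complexity-upper {B} D≤B = begin
          (c N + p N) + 2 * N            ≤⟨ +-monoˡ-≤ (2 * N) reps-lower ⟩
          (length R + length R) + 2 * N  ≡⟨ double (length R) N ⟩
          2 * (length R + N)             ≤⟨ *-monoʳ-≤ 2 (+-cancelˡ-≤ (suc M + length (long s)) _ _ step) ⟩
          2 * (sumTo p N + B)            ≡⟨ distrib (sumTo p N) B ⟩
          2 * B + 2 * sumTo p N          ∎
          where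
          open ≤-Reasoning
          L : ℕ
          L = length (long s)
          v : Word k
          v = prefix u (M + N)
          double : ∀ r n → (r + r) + 2 * n ≡ 2 * (r + n)
          double = ℕ-solve-∀
          distrib : ∀ x b → 2 * (x + b) ≡ 2 * b + 2 * x
          distrib = ℕ-solve-∀
          shuffle₁ : ∀ m l r n → suc m + l + (r + n) ≡ suc (m + n) + (r + l)
          shuffle₁ = ℕ-solve-∀
          shuffle₂ : ∀ x l b m → x + l + b + suc m ≡ suc m + l + (x + b)
          shuffle₂ = ℕ-solve-∀
          -- The summand `suc M + L` lets the defect estimate and `long-bound` be added without
          -- subtraction.
          step : suc M + L + (length R + N) ≤ suc M + L + (sumTo p N + B)
          step = begin
            suc M + L + (length R + N)                        ≡⟨ shuffle₁ M L (length R) N ⟩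
            suc (M + N) + (length R + L)                      ≡⟨ cong (λ l → suc l + (length R + L)) (length-factorAt 0 (M + N)) ⟨
            -- `defect` is a truncated difference, so the number of palindromes plus the defect is
            -- at least the length plus one.
            suc (length v) + (length R + L)                   ≤⟨ +-mono-≤ (m≤n+m∸n (suc (length v)) (length (palFactors v))) (long-bound s) ⟩
            length (palFactors v) + defect v + suc M          ≤⟨ +-monoˡ-≤ (suc M) (+-mono-≤ palFactors≤short+long (D≤B (M + N))) ⟩
            length (short s) + L + B + suc M                  ≤⟨ +-monoˡ-≤ (suc M) (+-monoˡ-≤ B (+-monoˡ-≤ L short≤sumTo)) ⟩
            sumTo p N + L + B + suc M                         ≡⟨ shuffle₂ (sumTo p N) L B M ⟩
            suc M + L + (sumTo p N + B)                       ∎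

-- Telescoping the sum of T.

partialSum-T : ∀ c p → c 0 ≡ p 0 → ∀ N →
               partialSum (T c p) N ℤ.+ pos (2 * sumTo p N) ≡ pos ((c N + p N) + 2 * N)
partialSum-T c p c0≡p0 zero rewrite c0≡p0 = cong pos (identity (p 0))
  where
  identity : ∀ x → 2 * x ≡ (x + x) + 2 * 0
  identity = ℕ-solve-∀
partialSum-T c p c0≡p0 (suc N) = begin
  S ℤ.+ T c p N ℤ.+ pos (2 * (p′ + σ))
    ≡⟨ cong (λ z → S ℤ.+ T c p N ℤ.+ pos z) (*-distribˡ-+ 2 p′ σ) ⟩
  S ℤ.+ T c p N ℤ.+ (pos (2 * p′) ℤ.+ pos (2 * σ))
    ≡⟨ rearrange S (T c p N) (pos (2 * p′)) (pos (2 * σ)) ⟩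
  (S ℤ.+ pos (2 * σ)) ℤ.+ (T c p N ℤ.+ pos (2 * p′))
    ≡⟨ cong₂ (λ y z → y ℤ.+ (T c p N ℤ.+ z)) (partialSum-T c p c0≡p0 N) (pos-2* p′) ⟩
  (pos (c N) ℤ.+ pos (p N) ℤ.+ pos (2 * N)) ℤ.+ (T c p N ℤ.+ (pos p′ ℤ.+ pos p′))
    -- In T(N) the terms -C(N) and -P(N) cancel the old ones, and of 2 P(N + 1) one copy survives.
    ≡⟨ cancel (pos (c N)) (pos (p N)) (pos (2 * N)) (pos (c (suc N))) (pos p′) ⟩
  pos (c (suc N)) ℤ.+ pos p′ ℤ.+ (pos 2 ℤ.+ pos (2 * N))
    ≡⟨ cong (λ z → pos (c (suc N) + p′ + z)) (*-suc 2 N) ⟨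
  pos ((c (suc N) + p′) + 2 * suc N)
    ∎
  where
  open ≡-Reasoning
  S : ℤ
  S = partialSum (T c p) N
  p′ σ : ℕ
  p′ = p (suc N)
  σ = sumTo p N
  pos-2* : ∀ n → pos (2 * n) ≡ pos n ℤ.+ pos n
  pos-2* n = cong (λ z → pos (n + z)) (+-identityʳ n)
  rearrange : ∀ s t x y → s ℤ.+ t ℤ.+ (x ℤ.+ y) ≡ (s ℤ.+ y) ℤ.+ (t ℤ.+ x)
  rearrange = ℤ-solve-∀
  cancel : ∀ a b n a′ b′ →
    (a ℤ.+ b ℤ.+ n) ℤ.+ (((((a′ ℤ.- a) ℤ.+ pos 2) ℤ.- b′) ℤ.- b) ℤ.+ (b′ ℤ.+ b′)) ≡ a′ ℤ.+ b′ ℤ.+ (pos 2 ℤ.+ n)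
  cancel = ℤ-solve-∀

-- Integer bounds and the equivalence.

ℤ-+-cancelʳ-≤ : ∀ k {i j} → i ℤ.+ k ℤ.≤ j ℤ.+ k → i ℤ.≤ j
ℤ-+-cancelʳ-≤ k {i} {j} le = subst₂ ℤ._≤_ (add-sub i k) (add-sub j k) (ℤ.+-monoˡ-≤ (ℤ.- k) le)
  where
  add-sub : ∀ x y → x ℤ.+ y ℤ.- y ≡ x
  add-sub = ℤ-solve-∀

i≤pos∣i∣ : ∀ i → i ℤ.≤ pos ∣ i ∣
i≤pos∣i∣ (pos n)      = ℤ.≤-refl
i≤pos∣i∣ (ℤ.-[1+ n ]) = ℤ.-≤+

theorem2 : (k : ℕ) (u : InfWord k) → ClosedUnderReversal u →
    (c p : ℕ → ℕ) → IsFactorComplexity u c → IsPalindromicComplexity u p →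
    FiniteDefect u ⇔ FiniteSum (T c p)
theorem2 k u closed c p hc hp = mk⇔ defect⇒sum sum⇒defect
  where
  telescope : ∀ N → partialSum (T c p) N ℤ.+ pos (2 * sumTo p N) ≡ pos ((c N + p N) + 2 * N)
  telescope = partialSum-T c p (c0≡p0 u hc hp)

  defect⇒sum : FiniteDefect u → FiniteSum (T c p)
  defect⇒sum (B , D≤B) = pos (2 * B) , λ N → ℤ-+-cancelʳ-≤ (pos (2 * sumTo p N))
    (subst (ℤ._≤ pos (2 * B + 2 * sumTo p N)) (sym (telescope N))
      (ℤ.+≤+ (complexity-upper u hc hp N D≤B)))

  sum⇒defect : FiniteSum (T c p) → FiniteDefect u
  -- The bound on the partial sums is an integer, so its absolute value serves as the natural bound
  -- on the defect.
  sum⇒defect (B , S≤B) = ∣ B ∣ , bound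
    where
    bound : ∀ N → defect (prefix u N) ≤ ∣ B ∣
    bound N = m≤n+o⇒m∸n≤o (suc (length (prefix u N))) π
      (subst (λ l → suc l ≤ π + ∣ B ∣) (sym (length-factorAt u 0 N))
        (*-cancelˡ-≤ 2 (+-cancelˡ-≤ (2 * σ) _ _ step)))
      where
      open ≤-Reasoning
      π σ : ℕ
      π = length (palFactors (prefix u N))
      σ = sumTo p N
      upper : (c N + p N) + 2 * N ≤ ∣ B ∣ + 2 * σ
      upper = ℤ.drop‿+≤+ (subst (ℤ._≤ pos (∣ B ∣ + 2 * σ)) (telescope N)
        (ℤ.+-monoˡ-≤ (pos (2 * σ)) (ℤ.≤-trans (S≤B N) (i≤pos∣i∣ B))))
      regroup : ∀ x n → 2 * x + 2 * suc n ≡ 2 * suc x + 2 * n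
      regroup = ℕ-solve-∀
      swap : ∀ x n y → x + 2 * y + 2 * n ≡ x + 2 * n + 2 * y
      swap = ℕ-solve-∀
      collect : ∀ b x y → 2 * b + 2 * x + 2 * y ≡ 2 * x + 2 * (y + b)
      collect = ℕ-solve-∀
      step : 2 * σ + 2 * suc N ≤ 2 * σ + 2 * (π + ∣ B ∣)
      step = begin
        2 * σ + 2 * suc N              ≡⟨ regroup σ N ⟩
        2 * suc σ + 2 * N              ≤⟨ +-monoˡ-≤ (2 * N) (complexity-lower u hc hp N closed) ⟩
        (c N + p N) + 2 * π + 2 * N    ≡⟨ swap (c N + p N) N π ⟩
        (c N + p N) + 2 * N + 2 * π    ≤⟨ +-monoˡ-≤ (2 * π) upper ⟩
        -- Weakening `∣ B ∣` to its double avoids halving: every term is then even and the factor 2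
        -- cancels.
        ∣ B ∣ + 2 * σ + 2 * π          ≤⟨ +-monoˡ-≤ (2 * π) (+-monoˡ-≤ (2 * σ) (m≤n*m ∣ B ∣ 2)) ⟩
        2 * ∣ B ∣ + 2 * σ + 2 * π      ≡⟨ collect ∣ B ∣ σ π ⟩
        2 * σ + 2 * (π + ∣ B ∣)        ∎
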